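{- There exists a constant $c_2 > 0$ such that the following holds for all positive integers $n$. Let $\varepsilon_1, \ldots, \varepsilon_n$ be i.i.d. Rademacher random variables and set $a_i = 3i + \varepsilon_i$ for $1 \leq i \leq n$. Then with positive probability, $|S(a)| \geq c_2 n^2$.
   Context: A Rademacher random variable takes the values $1$ and $-1$ each with probability $\frac{1}{2}$. For a finite sequence of integers $a = (a_i)_{1 \leq i \leq k}$, $S(a) = \{\sum_{i=u}^{v} a_i \mid 1 \leq u \leq v \leq k\}$ is the set of its consecutive sums. -}

module Defs where

open import Data.Nat as ℕ using (ℕ; zero; suc; _^_)
open import Data.Nat.Properties using (m^n≢0)
open import Data.Integer as ℤ using (ℤ; +_)
open import Data.Bool using (Bool; true; false; T)
open import Data.Fin using (Fin; toℕ)
open import Data.Vec as Vec using (Vec; []; _∷_)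
open import Data.List as List using (List; []; _∷_; _++_; length; map; deduplicate; filter; concatMap)
open import Data.Rational as ℚ using (ℚ; _/_; _≤_; _*_)
open import Data.Rational.Properties using (_≤?_)

sign : Bool → ℤ
sign true = + 1
sign false = ℤ.- (+ 1)

-- All 2^n outcomes of (ε₁,…,εₙ), each having probability 1/2^n.
allSigns : (n : ℕ) → List (Vec Bool n)
allSigns zero = [] ∷ []
allSigns (suc n) = concatMap (λ v → (true ∷ v) ∷ (false ∷ v) ∷ []) (allSigns n)

-- The sequence a_i = 3 i + ε_i, 1 ≤ i ≤ n (position i of the list is index i+1).
seqA : {n : ℕ} → Vec Bool n → List ℤ
seqA {n} ε = Vec.toList (Vec.tabulate (λ (i : Fin n) →
  (+ 3) ℤ.* (+ suc (toℕ i)) ℤ.+ sign (Vec.lookup ε i)))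

initialSums : List ℤ → List ℤ
initialSums [] = []
initialSums (x ∷ xs) = x ∷ map (λ s → x ℤ.+ s) (initialSums xs)

consecSums : List ℤ → List ℤ
consecSums [] = []
consecSums (x ∷ xs) = initialSums (x ∷ xs) ++ consecSums xs

cardS : List ℤ → ℕ
cardS a = length (deduplicate ℤ._≟_ a')
  where a' = consecSums a

probBig : ℚ → (n : ℕ) → ℚ
probBig c n =
  _/_ (+ length (filter (λ ε → c * ((+ (n ℕ.* n)) / 1) ≤? ((+ cardS (seqA ε)) / 1)) (allSigns n)))
    (2 ^ n) {{m^n≢0 2 n}}

{-# OPTIONS --safe #-}
module Submission where

-- For a suitable sign pattern the partial sums of a are f(j) = P(j) + 2 ⌊(j ∸ v₀) t / W⌋ with
-- P(j) = (3j² + j)/2: all signs are -1 up to v₀, and from there on the signs follow a line of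
-- slope t/W, 0 ≤ t < W.  We consider the sums f(v) - f(u) with v ∈ [v₀, v₀ + W) and
-- u ∈ [N, 2N), where v₀ = 2N and N = 18 W.  If (u, v) and (u + h, v + d), d > 0, give the same
-- sum, then d ≤ h < 3d.  Moreover, as t varies the sum of a pair (u, v) moves relative to that of
-- (u + h, v + d) by at most 2d < 3h, so for fixed v, d, h a single u can occur; and for this u
-- the value ⌊(w + d) t / W⌋ - ⌊w t / W⌋, w = v - v₀, is prescribed, which leaves at most 3W/d
-- slopes t.  Summing over h and then over d and v, there are at most 9W · W² collisions in total
-- over the W slopes, so some slope has at most 9W² of them among its W N = 18W² pairs (u, v).

open import Defs
open import Data.Bool using (Bool; true; false)
open import Data.Fin using (toℕ)
open import Data.Integer as ℤ using (ℤ; +_; _-_)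
import Data.Integer.Properties as ℤ
import Data.Integer.Tactic.RingSolver as ℤ
open import Data.List using (List; []; _∷_; _++_; length; map; filter; downFrom; cartesianProduct)
open import Data.List.Membership.Propositional using (_∈_; _─_)
open import Data.List.Membership.Propositional.Properties
open import Data.List.Properties using (length-map; length-++; length-downFrom; length-removeAt′; map-++; map-∘; map-cong)
open import Data.List.Relation.Unary.All as All using (All; []; _∷_)
open import Data.List.Relation.Unary.AllPairs using ([]; _∷_)
open import Data.List.Relation.Unary.Any as Any using (here; there; index)
open import Data.List.Relation.Unary.Unique.Propositional using (Unique)
import Data.List.Relation.Unary.Unique.Propositional.Properties as Unique
open import Data.Nat
open import Data.Nat.DivMod
open import Data.Nat.Divisibility using (n∣m*n)
open import Data.Nat.ListAction using (sum)
open import Data.Nat.ListAction.Properties using (sum-++)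
open import Data.Nat.Properties
open import Data.Nat.Tactic.RingSolver using (solve-∀)
open import Data.Product using (Σ; ∃; ∃₂; _×_; _,_; map₁; map₂)
open import Data.Rational as ℚ using (ℚ; 0ℚ)
import Data.Rational.Properties as ℚ
open import Data.Rational.Unnormalised as ℚᵘ using (mkℚᵘ; *≤*)
import Data.Rational.Unnormalised.Properties as ℚᵘ
open import Data.Sum using (_⊎_; inj₁; inj₂)
open import Data.Vec as Vec using (Vec)
open import Data.Vec.Properties using (lookup∘tabulate; tabulate-cong)
open import Function using (_∘_)
open import Relation.Binary.Definitions using (tri<; tri≈; tri>)
open import Relation.Binary.PropositionalEquality
open import Relation.Nullary using (¬_; Dec; yes; no; does; contradiction)
open import Relation.Nullary.Decidable using (map′; dec-true; dec-false)

private variable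
  A B : Set

-- Duplicate-free lists and their lengths

∈-─⁺ : {x y : A} {ys : List A} (p : x ∈ ys) → y ∈ ys → x ≢ y → y ∈ (ys ─ p)
∈-─⁺ (here refl) (here refl) x≢y = contradiction refl x≢y
∈-─⁺ (here _)    (there q)   _   = q
∈-─⁺ (there _)   (here refl) _   = here refl
∈-─⁺ (there p)   (there q)   x≢y = there (∈-─⁺ p q x≢y)

unique-⊆⇒length≤ : {xs ys : List A} → Unique xs → (∀ {x} → x ∈ xs → x ∈ ys) → length xs ≤ length ys
unique-⊆⇒length≤ {xs = []} _ _ = z≤n
unique-⊆⇒length≤ {xs = x ∷ xs} {ys} (x∉xs ∷ xs!) xs⊆ys = begin
  suc (length xs)          ≤⟨ s≤s (unique-⊆⇒length≤ xs! (λ y∈xs → ∈-─⁺ x∈ys (xs⊆ys (there y∈xs)) (All.lookup x∉xs y∈xs))) ⟩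
  suc (length (ys ─ x∈ys)) ≡⟨ length-removeAt′ ys (index x∈ys) ⟨
  length ys                ∎
  where
  open ≤-Reasoning
  x∈ys = xs⊆ys (here refl)

-- Injectivity is asked for on members only, because `value` below is shown to be injective just on
-- the list `good`.
map-unique : (f : A → B) {xs : List A} → (∀ {x y} → x ∈ xs → y ∈ xs → f x ≡ f y → x ≡ y) →
  Unique xs → Unique (map f xs)
map-unique f {[]} inj [] = []
map-unique f {x ∷ xs} inj (x∉xs ∷ xs!) =
  fresh xs x∉xs (λ y∈xs → inj (here refl) (there y∈xs)) ∷ map-unique f (λ p q → inj (there p) (there q)) xs!
  where
  fresh : ∀ ys → All (x ≢_) ys → (∀ {y} → y ∈ ys → f x ≡ f y → x ≡ y) → All (f x ≢_) (map f ys)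
  fresh [] _ _ = []
  fresh (y ∷ ys) (x≢y ∷ x∉ys) i = (x≢y ∘ i (here refl)) ∷ fresh ys x∉ys (i ∘ there)

length-cartesianProduct : (xs : List A) (ys : List B) → length (cartesianProduct xs ys) ≡ length xs * length ys
length-cartesianProduct [] ys = refl
length-cartesianProduct (x ∷ xs) ys = trans (length-++ (map (x ,_) ys))
  (cong₂ _+_ (length-map (x ,_) ys) (length-cartesianProduct xs ys))

-- Finite sums, averaging and counting

sumOver : List A → (A → ℕ) → ℕ
sumOver xs f = sum (map f xs)

sumOver-cong : (xs : List A) {f g : A → ℕ} → (∀ x → f x ≡ g x) → sumOver xs f ≡ sumOver xs g
sumOver-cong xs f≗g = cong sum (map-cong f≗g xs)

sumOver-0 : (xs : List A) → sumOver xs (λ _ → 0) ≡ 0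
sumOver-0 [] = refl
sumOver-0 (_ ∷ xs) = sumOver-0 xs

sumOver-+ : (xs : List A) (f g : A → ℕ) → sumOver xs (λ x → f x + g x) ≡ sumOver xs f + sumOver xs g
sumOver-+ [] f g = refl
sumOver-+ (x ∷ xs) f g = trans (cong (λ s → f x + g x + s) (sumOver-+ xs f g)) (interchange (f x) (g x) _ _)
  where
  interchange : ∀ a b c d → a + b + (c + d) ≡ a + c + (b + d)
  interchange = solve-∀

sumOver-swap : (xs : List A) (ys : List B) (f : A → B → ℕ) →
  sumOver xs (λ x → sumOver ys (f x)) ≡ sumOver ys (λ y → sumOver xs (λ x → f x y))
sumOver-swap [] ys f = sym (sumOver-0 ys)
sumOver-swap (x ∷ xs) ys f = trans (cong (λ s → sumOver ys (f x) + s) (sumOver-swap xs ys f))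
  (sym (sumOver-+ ys (f x) (λ y → sumOver xs (λ x → f x y))))

sumOver-cartesianProduct : (xs : List A) (ys : List B) (f : A × B → ℕ) →
  sumOver (cartesianProduct xs ys) f ≡ sumOver xs (λ x → sumOver ys (λ y → f (x , y)))
sumOver-cartesianProduct [] ys f = refl
sumOver-cartesianProduct (x ∷ xs) ys f = begin
  sum (map f (map (x ,_) ys ++ cartesianProduct xs ys))
    ≡⟨ cong sum (map-++ f (map (x ,_) ys) (cartesianProduct xs ys)) ⟩
  sum (map f (map (x ,_) ys) ++ map f (cartesianProduct xs ys))
    ≡⟨ sum-++ (map f (map (x ,_) ys)) _ ⟩
  sum (map f (map (x ,_) ys)) + sumOver (cartesianProduct xs ys) f
    ≡⟨ cong₂ _+_ (cong sum (sym (map-∘ ys))) (sumOver-cartesianProduct xs ys f) ⟩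
  sumOver ys (λ y → f (x , y)) + sumOver xs (λ x → sumOver ys (λ y → f (x , y))) ∎
  where open ≡-Reasoning

-- The factor `k` replaces a division: a bound b/k per term, such as 3W/d, is stated without leaving
-- ℕ.
*-sumOver-≤ : (k : ℕ) (xs : List A) {f : A → ℕ} {b : ℕ} → (∀ {x} → x ∈ xs → k * f x ≤ b) →
  k * sumOver xs f ≤ length xs * b
*-sumOver-≤ k [] _ = ≤-reflexive (*-zeroʳ k)
*-sumOver-≤ k (x ∷ xs) {f} {b} h = begin
  k * (f x + sumOver xs f)     ≡⟨ *-distribˡ-+ k (f x) _ ⟩
  k * f x + k * sumOver xs f   ≤⟨ +-mono-≤ (h (here refl)) (*-sumOver-≤ k xs (h ∘ there)) ⟩
  b + length xs * b            ∎
  where open ≤-Reasoning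

*-sumOver-swap-≤ : (k : ℕ) (ts : List B) (xs : List A) {f : B → A → ℕ} {b : ℕ} →
  (∀ {x} → x ∈ xs → k * sumOver ts (λ t → f t x) ≤ b) →
  k * sumOver ts (λ t → sumOver xs (f t)) ≤ length xs * b
*-sumOver-swap-≤ k ts xs {f} h =
  ≤-trans (≤-reflexive (cong (k *_) (sumOver-swap ts xs f))) (*-sumOver-≤ k xs h)

sumOver≡0⇒≡0 : (xs : List A) {f : A → ℕ} {x : A} → sumOver xs f ≡ 0 → x ∈ xs → f x ≡ 0
sumOver≡0⇒≡0 (_ ∷ _) {f} {x} eq (here refl) = m+n≡0⇒m≡0 (f x) eq
sumOver≡0⇒≡0 (y ∷ xs) {f} eq (there x∈xs) = sumOver≡0⇒≡0 xs (m+n≡0⇒n≡0 (f y) eq) x∈xs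

sumOver≢0⇒∃ : (xs : List A) {f : A → ℕ} → sumOver xs f ≢ 0 → ∃ λ x → x ∈ xs × f x ≢ 0
sumOver≢0⇒∃ [] ne = contradiction refl ne
sumOver≢0⇒∃ (x ∷ xs) {f} ne with f x ≟ 0
... | no fx≢0 = x , here refl , fx≢0
... | yes fx≡0 with sumOver≢0⇒∃ xs (λ eq → ne (cong₂ _+_ fx≡0 eq))
...   | y , y∈xs , fy≢0 = y , there y∈xs , fy≢0

-- At most one term is non-zero, so the whole sum obeys the bound for a single term.
*-sumOver-single-≤ : (k : ℕ) {xs : List A} {f : A → ℕ} {b : ℕ} → Unique xs →
  (∀ {x y} → x ∈ xs → y ∈ xs → f x ≢ 0 → f y ≢ 0 → x ≡ y) →
  (∀ {x} → x ∈ xs → k * f x ≤ b) → k * sumOver xs f ≤ b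
*-sumOver-single-≤ k {[]} _ _ _ = ≤-trans (≤-reflexive (*-zeroʳ k)) z≤n
*-sumOver-single-≤ k {x ∷ xs} {f} {b} (x∉xs ∷ xs!) single h with f x ≟ 0
... | yes fx≡0 rewrite fx≡0 = *-sumOver-single-≤ k xs! (λ p q → single (there p) (there q)) (h ∘ there)
... | no fx≢0 with sumOver xs f ≟ 0
...   | yes eq rewrite eq | +-identityʳ (f x) = h (here refl)
...   | no ne with sumOver≢0⇒∃ xs ne
...     | y , y∈xs , fy≢0 = contradiction (single (here refl) (there y∈xs) fx≢0 fy≢0) (All.lookup x∉xs y∈xs)

-- If the head exceeds `b`, removing it leaves a tail whose average is still at most `b`.
∃-≤-average : (xs : List A) {f : A → ℕ} {b : ℕ} → 0 < length xs → sumOver xs f ≤ length xs * b →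
  ∃ λ x → x ∈ xs × f x ≤ b
∃-≤-average (x ∷ xs) {f} {b} _ s≤ with f x ≤? b
... | yes fx≤b = x , here refl , fx≤b
... | no fx≰b with xs
...   | [] = contradiction (+-cancelʳ-≤ 0 _ _ s≤) fx≰b
...   | z ∷ zs with ∃-≤-average (z ∷ zs) z<s (+-cancelˡ-≤ b _ _ (≤-trans (+-monoˡ-≤ _ (<⇒≤ (≰⇒> fx≰b))) s≤))
...     | y , y∈ , fy≤b = y , there y∈ , fy≤b

-- An entry that the filter drops has `f x` at least 1, so it is paid for by the sum.
length≤filter+sumOver : (f : A → ℕ) (xs : List A) →
  length xs ≤ length (filter (λ x → f x ≟ 0) xs) + sumOver xs f
length≤filter+sumOver f [] = z≤n
length≤filter+sumOver f (x ∷ xs) with f x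
... | zero = s≤s (length≤filter+sumOver f xs)
... | suc k = begin
  suc (length xs)                             ≤⟨ s≤s (length≤filter+sumOver f xs) ⟩
  suc (l + s)                                 ≡⟨ +-suc l s ⟨
  l + suc s                                   ≤⟨ +-monoʳ-≤ l (s≤s (m≤n+m s k)) ⟩
  l + (suc k + s)                             ∎
  where
  open ≤-Reasoning
  l = length (filter (λ x → f x ≟ 0) xs)
  s = sumOver xs f

indicator : {P : Set} → Dec P → ℕ
indicator (yes _) = 1
indicator (no _) = 0

indicator≡0⇒¬ : {P : Set} (P? : Dec P) → indicator P? ≡ 0 → ¬ P
indicator≡0⇒¬ (no ¬p) _ = ¬p

indicator≢0⇒ : {P : Set} (P? : Dec P) → indicator P? ≢ 0 → P
indicator≢0⇒ (yes p) _ = p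
indicator≢0⇒ (no _) ne = contradiction refl ne

module _ {P : ℕ → Set} (P? : ∀ x → Dec (P x)) where

  count : ℕ → ℕ
  count n = sumOver (downFrom n) (λ x → indicator (P? x))

  -- The witnesses `x` and `x + s` built by the recursion are the least and the greatest solution
  -- below `n`; all solutions lie between them, among `s + 1` numbers.
  count≤span : ∀ n → count n ≡ 0 ⊎ (∃₂ λ x s → P x × P (x + s) × x + s < n × count n ≤ suc s)
  count≤span zero = inj₁ refl
  count≤span (suc n) with P? n | count≤span n
  ... | no _  | inj₁ eq = inj₁ eq
  ... | no _  | inj₂ (x , s , px , py , y<n , c≤) = inj₂ (x , s , px , py , m<n⇒m<1+n y<n , c≤)
  ... | yes p | inj₁ eq =
    inj₂ (n , 0 , p , subst P (sym (+-identityʳ n)) p , s≤s (≤-reflexive (+-identityʳ n)) , s≤s (≤-reflexive eq))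
  ... | yes p | inj₂ (x , s , px , _ , y<n , c≤) =
    inj₂ (x , n ∸ x , px , subst P (sym x+[n∸x]≡n) p , s≤s (≤-reflexive x+[n∸x]≡n) , s≤s (≤-trans c≤ s<n∸x))
    where
    x+[n∸x]≡n = m+[n∸m]≡n (≤-trans (m≤m+n x s) (<⇒≤ y<n))
    s<n∸x : s < n ∸ x
    s<n∸x = subst (_≤ n ∸ x) (m+n∸m≡n x (suc s)) (∸-monoˡ-≤ x (≤-trans (≤-reflexive (+-suc x s)) y<n))

  -- Solutions within a span of k/d number at most k/d + 1; the extra 1 becomes the summand `d`.
  count-spread : ∀ n d {k} → (∀ x s → P x → P (x + s) → x + s < n → d * s ≤ k) → d * count n ≤ k + d
  count-spread n d {k} h with count≤span n
  ... | inj₁ eq rewrite eq | *-zeroʳ d = z≤n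
  ... | inj₂ (x , s , px , py , y<n , c≤) = begin
    d * count n ≤⟨ *-monoʳ-≤ d c≤ ⟩
    d * suc s   ≡⟨ *-suc d s ⟩
    d + d * s   ≤⟨ +-monoʳ-≤ d (h x s px py y<n) ⟩
    d + k       ≡⟨ +-comm d k ⟩
    k + d       ∎
    where open ≤-Reasoning

-- Quadratic partial sums and the collision equation

-- pent j is the sum of 3i - 1 over 1 ≤ i ≤ j.
pent : ℕ → ℕ
pent zero = 0
pent (suc j) = pent j + (3 * j + 2)

-- `pent` is the quadratic (3j² + j)/2, and 3uh is the cross term of its expansion at u + h.
pent-+ : ∀ u h → pent (u + h) ≡ pent u + (pent h + 3 * u * h)
pent-+ u zero = trans (cong pent (+-identityʳ u))
  (sym (trans (cong (λ s → pent u + s) (*-zeroʳ (3 * u))) (+-identityʳ (pent u))))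
pent-+ u (suc h) rewrite +-suc u h | pent-+ u h = step (pent u) (pent h) u h
  where
  step : ∀ p q u h → p + (q + 3 * u * h) + (3 * (u + h) + 2) ≡ p + (q + (3 * h + 2) + 3 * u * suc h)
  step = solve-∀

pent-mono-≤ : ∀ {i j} → i ≤ j → pent i ≤ pent j
pent-mono-≤ {i} {j} i≤j = begin
  pent i             ≤⟨ m≤m+n (pent i) _ ⟩
  _                  ≡⟨ pent-+ i (j ∸ i) ⟨
  pent (i + (j ∸ i)) ≡⟨ cong pent (m+[n∸m]≡n i≤j) ⟩
  pent j             ∎
  where open ≤-Reasoning

pent-mono-< : ∀ {i j} → i < j → pent i < pent j
pent-mono-< {i} i<j = <-≤-trans (m<m+n (pent i) (<-≤-trans z<s (m≤n+m 2 (3 * i)))) (pent-mono-≤ i<j)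

-- After cancellation with pent-+: the sums for (u , v) and (u + h , v + d) agree, where b and a
-- are the values of ⌊(j ∸ v₀) t / W⌋ at v and v + d.
record Collision (u v d h a b : ℕ) : Set where
  constructor collision
  field
    equation : pent d + 3 * v * d + 2 * a ≡ pent h + 3 * u * h + 2 * b

open Collision

collision? : ∀ u v d h a b → Dec (Collision u v d h a b)
collision? u v d h a b = map′ collision equation (pent d + 3 * v * d + 2 * a ≟ pent h + 3 * u * h + 2 * b)

-- If h < d, each term on the left of the equation is at least its counterpart on the right, and
-- `pent d` exceeds `pent h`.
collision⇒d≤h : ∀ {u v d h a b} → u ≤ v → b ≤ a →
  Collision u v d h a b → d ≤ h
collision⇒d≤h {u} {v} {d} {h} {a} {b} u≤v b≤a c with d ≤? h
... | yes d≤h = d≤h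
... | no d≰h = contradiction (sym (equation c)) (<⇒≢
  (+-mono-<-≤ (+-mono-<-≤ (pent-mono-< h<d) (*-mono-≤ (*-monoʳ-≤ 3 u≤v) (<⇒≤ h<d))) (*-monoʳ-≤ 2 b≤a)))
  where h<d = ≰⇒> d≰h

-- The rise a - b adds at most 2d to the left, so beyond `pent d` and 2b the left has at most (3v +
-- 2)d. If h ≥ 3d, the right has at least 9ud there, which is more.
collision⇒h<3d : ∀ {u v d h a b} → 0 < d → 3 * v + 2 < 9 * u → a ≤ b + d →
  Collision u v d h a b → h < 3 * d
collision⇒h<3d {u} {v} {d} {h} {a} {b} 0<d v<u a≤b+d c with h <? 3 * d
... | yes h<3d = h<3d
... | no h≮3d = contradiction (equation c) (<⇒≢ (begin-strict
  pent d + 3 * v * d + 2 * a        ≤⟨ +-monoʳ-≤ (pent d + 3 * v * d) (*-monoʳ-≤ 2 a≤b+d) ⟩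
  pent d + 3 * v * d + 2 * (b + d)  ≡⟨ eq₁ (pent d) v d b ⟩
  pent d + ((3 * v + 2) * d + 2 * b) <⟨ +-monoʳ-< (pent d) (+-monoˡ-< (2 * b) (*-monoˡ-< d {{>-nonZero 0<d}} v<u)) ⟩
  pent d + (9 * u * d + 2 * b)      ≡⟨ eq₂ (pent d) u d b ⟩
  pent d + 3 * u * (3 * d) + 2 * b  ≤⟨ +-monoˡ-≤ (2 * b) (+-mono-≤ (pent-mono-≤ (≤-trans (m≤n*m d 3) 3d≤h))
                                         (*-monoʳ-≤ (3 * u) 3d≤h)) ⟩
  pent h + 3 * u * h + 2 * b        ∎))
  where
  open ≤-Reasoning
  3d≤h = ≮⇒≥ h≮3d
  eq₁ : ∀ p v d b → p + 3 * v * d + 2 * (b + d) ≡ p + ((3 * v + 2) * d + 2 * b)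
  eq₁ = solve-∀
  eq₂ : ∀ p u d b → p + (9 * u * d + 2 * b) ≡ p + 3 * u * (3 * d) + 2 * b
  eq₂ = solve-∀

-- Adding one equation to the other reversed cancels every term in `pent` and in `v`, so only the
-- `u`s and the rises a - b remain to be compared.
difference-of-collisions : ∀ {u₁ u₂ v d h a₁ a₂ b₁ b₂} → Collision u₁ v d h a₁ b₁ → Collision u₂ v d h a₂ b₂ →
  3 * u₂ * h + 2 * (a₁ + b₂) ≡ 3 * u₁ * h + 2 * (a₂ + b₁)
difference-of-collisions {u₁} {u₂} {v} {d} {h} {a₁} {a₂} {b₁} {b₂} c₁ c₂ =
  +-cancelˡ-≡ (pent d + 3 * v * d + pent h) _ _ (trans (shuffle (pent d + 3 * v * d) (pent h) (3 * u₂ * h) a₁ b₂)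
    (trans (cong₂ _+_ (equation c₁) (sym (equation c₂))) (shuffle′ (pent d + 3 * v * d) (pent h) (3 * u₁ * h) a₂ b₁)))
  where
  shuffle : ∀ l r x a b → l + r + (x + 2 * (a + b)) ≡ l + 2 * a + (r + x + 2 * b)
  shuffle = solve-∀
  shuffle′ : ∀ l r x a b → r + x + 2 * b + (l + 2 * a) ≡ l + r + (x + 2 * (a + b))
  shuffle′ = solve-∀

-- Here 3(u₂ - u₁)h equals twice the difference of the rises a₂ - b₂ and a₁ - b₁. The former is at
-- least 3h, the latter at most 2d ≤ 2h.
collision-u≮ : ∀ {u₁ u₂ v d h a₁ a₂ b₁ b₂} → 0 < d → d ≤ h → b₁ ≤ a₁ → a₂ ≤ b₂ + d →
  Collision u₁ v d h a₁ b₁ → Collision u₂ v d h a₂ b₂ → ¬ (u₁ < u₂)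
collision-u≮ {u₁} {u₂} {v} {d} {h} {a₁} {a₂} {b₁} {b₂} 0<d d≤h b₁≤a₁ a₂≤b₂+d c₁ c₂ u₁<u₂ =
  <⇒≢ (begin-strict
    3 * u₁ * h + 2 * (a₂ + b₁)          ≤⟨ +-monoʳ-≤ (3 * u₁ * h) (*-monoʳ-≤ 2 (+-mono-≤ a₂≤b₂+d b₁≤a₁)) ⟩
    3 * u₁ * h + 2 * (b₂ + d + a₁)      ≤⟨ +-monoʳ-≤ (3 * u₁ * h) (*-monoʳ-≤ 2 (+-monoˡ-≤ a₁ (+-monoʳ-≤ b₂ d≤h))) ⟩
    3 * u₁ * h + 2 * (b₂ + h + a₁)      <⟨ m<m+n _ (<-≤-trans 0<d d≤h) ⟩
    3 * u₁ * h + 2 * (b₂ + h + a₁) + h  ≡⟨ eq u₁ h a₁ b₂ ⟩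
    3 * suc u₁ * h + 2 * (a₁ + b₂)      ≤⟨ +-monoˡ-≤ _ (*-monoˡ-≤ h (*-monoʳ-≤ 3 u₁<u₂)) ⟩
    3 * u₂ * h + 2 * (a₁ + b₂)          ∎)
    (sym (difference-of-collisions c₁ c₂))
  where
  open ≤-Reasoning
  eq : ∀ u h a b → 3 * u * h + 2 * (b + h + a) + h ≡ 3 * suc u * h + 2 * (a + b)
  eq = solve-∀

-- Integer parts of lines of slope t/W

module Slope (W : ℕ) {{_ : NonZero W}} where

  level : ℕ → ℕ → ℕ
  level t w = (w * t) / W

  level-lower : ∀ t w → level t w * W ≤ w * t
  level-lower t w = m/n*n≤m (w * t) W

  level-upper : ∀ t w → w * t < W + level t w * W
  level-upper t w = begin-strict
    w * t                          ≡⟨ m≡m%n+[m/n]*n (w * t) W ⟩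
    (w * t) % W + level t w * W    <⟨ +-monoˡ-< (level t w * W) (m%n<n (w * t) W) ⟩
    W + level t w * W              ∎
    where open ≤-Reasoning

  level-mono : ∀ t w d → level t w ≤ level t (w + d)
  level-mono t w d = /-monoˡ-≤ W (*-monoˡ-≤ t (m≤m+n w d))

  level-lipschitz : ∀ {t} → t ≤ W → ∀ w d → level t (w + d) ≤ level t w + d
  level-lipschitz {t} t≤W w d = begin
    ((w + d) * t) / W      ≡⟨ cong (_/ W) (*-distribʳ-+ t w d) ⟩
    (w * t + d * t) / W    ≤⟨ /-monoˡ-≤ W (+-monoʳ-≤ (w * t) (*-monoʳ-≤ d t≤W)) ⟩
    (w * t + d * W) / W    ≡⟨ +-distrib-/-∣ʳ (w * t) (n∣m*n d) ⟩
    level t w + d * W / W  ≡⟨ cong (λ s → level t w + s) (m*n/n≡m d W) ⟩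
    level t w + d          ∎
    where open ≤-Reasoning

  -- The hypothesis says that slopes t and t + s rise equally from w to w + d. Without rounding the
  -- rises differ by ds/W; the four integer parts, each off by less than 1, can hide a difference of
  -- at most 2.
  equal-rise⇒close : ∀ w d t s → level t (w + d) + level (t + s) w ≡ level (t + s) (w + d) + level t w →
    d * s ≤ 2 * W
  equal-rise⇒close w d t s eq = +-cancelˡ-≤ ((w + d) * t + w * (t + s)) _ _ (begin
    (w + d) * t + w * (t + s) + d * s         ≡⟨ eq₁ w d t s ⟩
    (w + d) * (t + s) + w * t                 ≤⟨ +-mono-≤ (<⇒≤ (level-upper (t + s) (w + d))) (<⇒≤ (level-upper t w)) ⟩
    W + level (t + s) (w + d) * W + (W + level t w * W) ≡⟨ eq₂ W (level (t + s) (w + d)) (level t w) ⟩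
    (level (t + s) (w + d) + level t w) * W + 2 * W ≡⟨ cong (λ x → x * W + 2 * W) eq ⟨
    (level t (w + d) + level (t + s) w) * W + 2 * W
      ≡⟨ cong (_+ 2 * W) (*-distribʳ-+ W (level t (w + d)) (level (t + s) w)) ⟩
    level t (w + d) * W + level (t + s) w * W + 2 * W
      ≤⟨ +-monoˡ-≤ (2 * W) (+-mono-≤ (level-lower t (w + d)) (level-lower (t + s) w)) ⟩
    (w + d) * t + w * (t + s) + 2 * W         ∎)
    where
    open ≤-Reasoning
    eq₁ : ∀ w d t s → (w + d) * t + w * (t + s) + d * s ≡ (w + d) * (t + s) + w * t
    eq₁ = solve-∀
    eq₂ : ∀ W a b → W + a * W + (W + b * W) ≡ (a + b) * W + 2 * W
    eq₂ = solve-∀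

-- From one sign pattern to positive probability

∈-allSigns : ∀ {n} (ε : Vec Bool n) → ε ∈ allSigns n
∈-allSigns Vec.[] = here refl
∈-allSigns (true Vec.∷ ε) = ∈-concatMap⁺ (λ v → (true Vec.∷ v) ∷ (false Vec.∷ v) ∷ [])
  (Any.map (λ { refl → here refl }) (∈-allSigns ε))
∈-allSigns (false Vec.∷ ε) = ∈-concatMap⁺ (λ v → (true Vec.∷ v) ∷ (false Vec.∷ v) ∷ [])
  (Any.map (λ { refl → there (here refl) }) (∈-allSigns ε))

probBig-positive : ∀ c n (ε : Vec Bool n) →
  c ℚ.* ((+ (n * n)) ℚ./ 1) ℚ.≤ (+ cardS (seqA ε)) ℚ./ 1 → 0ℚ ℚ.< probBig c n
probBig-positive c n ε big =
  ℚ.positive⁻¹ (probBig c n) {{ℚ.normalize-pos _ (2 ^ n) {{m^n≢0 2 n}} {{>-nonZero (∈-length ε∈)}}}}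
  where
  ε∈ = ∈-filter⁺ (λ ε → c ℚ.* ((+ (n * n)) ℚ./ 1) ℚ.≤? ((+ cardS (seqA ε)) ℚ./ 1)) (∈-allSigns ε) big

-- In the unnormalised rationals numerators and denominators are visible, and the claim is a cross
-- multiplication.
1/[1+k]*m≤n : ∀ k m n → m ≤ suc k * n → ((+ 1) ℚ./ suc k) ℚ.* ((+ m) ℚ./ 1) ℚ.≤ (+ n) ℚ./ 1
1/[1+k]*m≤n k m n m≤kn = ℚ.toℚᵘ-cancel-≤ (begin
  ℚ.toℚᵘ (((+ 1) ℚ./ suc k) ℚ.* ((+ m) ℚ./ 1))             ≃⟨ ℚ.toℚᵘ-homo-* ((+ 1) ℚ./ suc k) ((+ m) ℚ./ 1) ⟩
  ℚ.toℚᵘ ((+ 1) ℚ./ suc k) ℚᵘ.* ℚ.toℚᵘ ((+ m) ℚ./ 1)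
    ≃⟨ ℚᵘ.*-cong (ℚ.toℚᵘ-fromℚᵘ (mkℚᵘ (+ 1) k)) (ℚ.toℚᵘ-fromℚᵘ (mkℚᵘ (+ m) 0)) ⟩
  mkℚᵘ (+ 1) k ℚᵘ.* mkℚᵘ (+ m) 0                       ≤⟨ *≤* ineq ⟩
  mkℚᵘ (+ n) 0                                         ≃⟨ ℚ.toℚᵘ-fromℚᵘ (mkℚᵘ (+ n) 0) ⟨
  ℚ.toℚᵘ ((+ n) ℚ./ 1)                                   ∎)
  where
  open ℚᵘ.≤-Reasoning
  ineq : ((+ 1) ℤ.* (+ m)) ℤ.* (+ 1) ℤ.≤ (+ n) ℤ.* (+ (suc k * 1))
  ineq rewrite ℤ.*-identityʳ ((+ 1) ℤ.* (+ m)) | ℤ.*-identityˡ (+ m) | *-identityʳ k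
             | sym (ℤ.pos-* n (suc k)) | *-comm n (suc k)
    = ℤ.+≤+ m≤kn

-- Consecutive sums as differences of partial sums

prefix : ∀ n → (ℕ → ℤ) → List ℤ
prefix n a = Vec.toList (Vec.tabulate {n = n} (λ i → a (toℕ i)))

-- `f` may be any sequence with increments `a`, with no condition on `f 0`, so that the induction
-- can pass to the shifted `a` and `f`.
initialSum∈ : ∀ n (a f : ℕ → ℤ) → (∀ i → f (suc i) ≡ f i ℤ.+ a i) →
  ∀ v → v < n → f (suc v) - f 0 ∈ initialSums (prefix n a)
initialSum∈ (suc n) a f step zero _ = here (trans (cong (_- f 0) (step 0)) (cancel (f 0) (a 0)))
  where
  cancel : ∀ x y → x ℤ.+ y - x ≡ y
  cancel = ℤ.solve-∀
initialSum∈ (suc n) a f step (suc v) (s≤s v<n) = there (subst (_∈ _) eq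
  (∈-map⁺ (λ s → a 0 ℤ.+ s) (initialSum∈ n (λ i → a (suc i)) (λ i → f (suc i)) (λ i → step (suc i)) v v<n)))
  where
  cancel : ∀ x y z → y ℤ.+ (z - (x ℤ.+ y)) ≡ z - x
  cancel = ℤ.solve-∀
  eq : a 0 ℤ.+ (f (2 + v) - f 1) ≡ f (2 + v) - f 0
  eq rewrite step 0 = cancel (f 0) (a 0) (f (2 + v))

consecSum∈ : ∀ n (a f : ℕ → ℤ) → (∀ i → f (suc i) ≡ f i ℤ.+ a i) →
  ∀ u v → u < v → v ≤ n → f v - f u ∈ consecSums (prefix n a)
consecSum∈ (suc n) a f step zero (suc v) _ v<n = ∈-++⁺ˡ (initialSum∈ (suc n) a f step v v<n)
consecSum∈ (suc n) a f step (suc u) (suc v) (s≤s u<v) (s≤s v≤n) = ∈-++⁺ʳ (initialSums (prefix (suc n) a))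
  (consecSum∈ n (λ i → a (suc i)) (λ i → f (suc i)) (λ i → step (suc i)) u v u<v v≤n)

-- Sign patterns given by a walk with steps 0 and 1

module Walk (g : ℕ → ℕ) (g-mono : ∀ i → g i ≤ g (suc i)) (g-lipschitz : ∀ i → g (suc i) ≤ suc (g i)) where

  -- Up to the constant 2 g(0) these are the partial sums of `term`: a step of `g` turns the
  -- increment 3i - 1 of `pent` into 3i + 1.
  height : ℕ → ℕ
  height j = pent j + 2 * g j

  rises : ℕ → Bool
  rises i = does (g (suc i) ≟ suc (g i))

  signs : ∀ n → Vec Bool n
  signs n = Vec.tabulate (λ i → rises (toℕ i))

  term : ℕ → ℤ
  term i = (+ 3) ℤ.* (+ suc i) ℤ.+ sign (rises i)

  seqA-signs : ∀ n → seqA (signs n) ≡ prefix n term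
  seqA-signs n = cong Vec.toList (tabulate-cong (λ i →
    cong (λ b → (+ 3) ℤ.* (+ suc (toℕ i)) ℤ.+ sign b) (lookup∘tabulate (λ i → rises (toℕ i)) i)))

  +height : ∀ j → + height j ≡ + pent j ℤ.+ (+ 2) ℤ.* (+ g j)
  +height j = trans (ℤ.pos-+ (pent j) (2 * g j)) (cong (λ x → (+ pent j) ℤ.+ x) (ℤ.pos-* 2 (g j)))

  +pent : ∀ j → + pent (suc j) ≡ + pent j ℤ.+ ((+ 3) ℤ.* (+ j) ℤ.+ (+ 2))
  +pent j = trans (ℤ.pos-+ (pent j) _)
    (cong (λ x → (+ pent j) ℤ.+ x) (trans (ℤ.pos-+ (3 * j) 2) (cong (λ x → x ℤ.+ (+ 2)) (ℤ.pos-* 3 j))))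

  -- The computation common to both cases of `height-step`: once `x` and `y` are known, the last
  -- hypothesis is a ring identity.
  height-step-by : ∀ i x y → + g (suc i) ≡ x → sign (rises i) ≡ y →
    (+ pent i ℤ.+ ((+ 3) ℤ.* (+ i) ℤ.+ (+ 2))) ℤ.+ (+ 2) ℤ.* x
      ≡ + pent i ℤ.+ (+ 2) ℤ.* (+ g i) ℤ.+ ((+ 3) ℤ.* ((+ 1) ℤ.+ (+ i)) ℤ.+ y) →
    + height (suc i) ≡ + height i ℤ.+ term i
  height-step-by i x y eqx eqy eq = begin
    + height (suc i)
      ≡⟨ +height (suc i) ⟩
    + pent (suc i) ℤ.+ (+ 2) ℤ.* (+ g (suc i))
      ≡⟨ cong₂ (λ p z → p ℤ.+ (+ 2) ℤ.* z) (+pent i) eqx ⟩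
    (+ pent i ℤ.+ ((+ 3) ℤ.* (+ i) ℤ.+ (+ 2))) ℤ.+ (+ 2) ℤ.* x
      ≡⟨ eq ⟩
    + pent i ℤ.+ (+ 2) ℤ.* (+ g i) ℤ.+ ((+ 3) ℤ.* (+ suc i) ℤ.+ y)
      ≡⟨ cong₂ (λ p z → p ℤ.+ ((+ 3) ℤ.* (+ suc i) ℤ.+ z)) (sym (+height i)) (sym eqy) ⟩
    + height i ℤ.+ term i ∎
    where open ≡-Reasoning

  height-step : ∀ i → + height (suc i) ≡ + height i ℤ.+ term i
  height-step i with m≤n⇒m<n∨m≡n (g-lipschitz i)
  ... | inj₂ eq = height-step-by i ((+ 1) ℤ.+ (+ g i)) (+ 1) (cong +_ eq)
    (cong sign (dec-true (g (suc i) ≟ suc (g i)) eq)) (up (+ pent i) (+ i) (+ g i))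
    where
    up : ∀ p i x → p ℤ.+ ((+ 3) ℤ.* i ℤ.+ (+ 2)) ℤ.+ (+ 2) ℤ.* ((+ 1) ℤ.+ x)
      ≡ p ℤ.+ (+ 2) ℤ.* x ℤ.+ ((+ 3) ℤ.* ((+ 1) ℤ.+ i) ℤ.+ (+ 1))
    up = ℤ.solve-∀
  ... | inj₁ g< = height-step-by i (+ g i) (ℤ.- (+ 1)) (cong +_ (≤-antisym (s≤s⁻¹ g<) (g-mono i)))
    (cong sign (dec-false (g (suc i) ≟ suc (g i)) (<⇒≢ g<))) (down (+ pent i) (+ i) (+ g i))
    where
    down : ∀ p i x → p ℤ.+ ((+ 3) ℤ.* i ℤ.+ (+ 2)) ℤ.+ (+ 2) ℤ.* x
      ≡ p ℤ.+ (+ 2) ℤ.* x ℤ.+ ((+ 3) ℤ.* ((+ 1) ℤ.+ i) ℤ.+ (ℤ.- (+ 1)))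
    down = ℤ.solve-∀

  height-difference∈ : ∀ n {u v} → u < v → v ≤ n → (+ height v) - (+ height u) ∈ consecSums (seqA (signs n))
  height-difference∈ n {u} {v} u<v v≤n rewrite seqA-signs n =
    consecSum∈ n term (λ j → + height j) height-step u v u<v v≤n

length≤cardS : ∀ {xs} a → Unique xs → (∀ {x} → x ∈ xs → x ∈ consecSums a) → length xs ≤ cardS a
length≤cardS a xs! xs⊆ = unique-⊆⇒length≤ xs! (λ x∈ → ∈-deduplicate⁺ ℤ._≟_ (xs⊆ x∈))

≡-differences : ∀ a b c d → (+ a) - (+ b) ≡ (+ c) - (+ d) → a + d ≡ c + b
≡-differences a b c d eq = ℤ.+-injective (begin
  + (a + d)                                      ≡⟨ ℤ.pos-+ a d ⟩
  (+ a) ℤ.+ (+ d)                                ≡⟨ shift (+ a) (+ b) (+ d) ⟩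
  ((+ a) - (+ b)) ℤ.+ ((+ b) ℤ.+ (+ d))          ≡⟨ cong (λ x → x ℤ.+ ((+ b) ℤ.+ (+ d))) eq ⟩
  ((+ c) - (+ d)) ℤ.+ ((+ b) ℤ.+ (+ d))          ≡⟨ unshift (+ c) (+ b) (+ d) ⟩
  (+ c) ℤ.+ (+ b)                                ≡⟨ ℤ.pos-+ c b ⟨
  + (c + b)                                      ∎)
  where
  open ≡-Reasoning
  shift : ∀ a b d → a ℤ.+ d ≡ (a - b) ℤ.+ (b ℤ.+ d)
  shift = ℤ.solve-∀
  unshift : ∀ c b d → (c - d) ℤ.+ (b ℤ.+ d) ≡ c ℤ.+ b
  unshift = ℤ.solve-∀

-- Collisions summed over all slopes

module Grid (W N : ℕ) {{_ : NonZero W}} (W<N : W < N) where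

  -- The steep part starts where the range [N, 2N) of `u` ends. Hence u < v, the heights at `u`
  -- carry no rounding term, and v < 3u still holds.
  v₀ : ℕ
  v₀ = N + N

  -- This serves `collision⇒h<3d` for every pair at once, as it compares an upper bound of all `v`
  -- with the least `u`. Strictness of W < N yields the 3 that covers the summand 2.
  v<3u : 3 * (v₀ + W) + 2 < 9 * N
  v<3u = begin-strict
    3 * (v₀ + W) + 2      <⟨ ≤-reflexive (eq₁ N W) ⟩
    6 * N + 3 * suc W     ≤⟨ +-monoʳ-≤ (6 * N) (*-monoʳ-≤ 3 W<N) ⟩
    6 * N + 3 * N         ≡⟨ *-distribʳ-+ N 6 3 ⟨
    9 * N                 ∎
    where
    open ≤-Reasoning
    eq₁ : ∀ N W → suc (3 * (N + N + W) + 2) ≡ 6 * N + 3 * suc W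
    eq₁ = solve-∀

  open Slope W

  Collides : ℕ → ℕ → ℕ → ℕ → ℕ → Set
  Collides t w k d h = Collision (N + k) (v₀ + w) d h (level t (w + d)) (level t w)

  collides? : ∀ t w k d h → Dec (Collides t w k d h)
  collides? t w k d h = collision? (N + k) (v₀ + w) d h (level t (w + d)) (level t w)

  N+k≤v₀+w : ∀ {k} → k < N → ∀ w → N + k ≤ v₀ + w
  N+k≤v₀+w k<N w = ≤-trans (+-monoʳ-≤ N (<⇒≤ k<N)) (m≤m+n v₀ w)

  collides-k-unique : ∀ {t₁ t₂ w k₁ k₂ d h} → t₁ < W → t₂ < W → k₁ < N → k₂ < N → 0 < d →
    Collides t₁ w k₁ d h → Collides t₂ w k₂ d h → k₁ ≡ k₂
  collides-k-unique {t₁} {t₂} {w} {k₁} {k₂} {d} {h} t₁<W t₂<W k₁<N k₂<N 0<d c₁ c₂ with <-cmp k₁ k₂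
  ... | tri≈ _ eq _ = eq
  ... | tri< lt _ _ = contradiction (+-monoʳ-< N lt)
    (collision-u≮ 0<d d≤h (level-mono t₁ w d) (level-lipschitz (<⇒≤ t₂<W) w d) c₁ c₂)
    where d≤h = collision⇒d≤h (N+k≤v₀+w k₁<N w) (level-mono t₁ w d) c₁
  ... | tri> _ _ gt = contradiction (+-monoʳ-< N gt)
    (collision-u≮ 0<d d≤h (level-mono t₂ w d) (level-lipschitz (<⇒≤ t₁<W) w d) c₂ c₁)
    where d≤h = collision⇒d≤h (N+k≤v₀+w k₁<N w) (level-mono t₁ w d) c₁

  -- Both collisions have the same `u`, so the difference of their equations leaves just equality of
  -- the two rises.
  collides-t-close : ∀ {w k d h} t s → Collides t w k d h → Collides (t + s) w k d h → d * s ≤ 2 * W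
  collides-t-close {w} {k} {d} {h} t s c₁ c₂ = equal-rise⇒close w d t s
    (*-cancelˡ-≡ _ _ 2 (+-cancelˡ-≡ (3 * (N + k) * h) _ _ (difference-of-collisions c₁ c₂)))

  slopes : List ℕ
  slopes = downFrom W

  grid : List (ℕ × ℕ)
  grid = cartesianProduct (downFrom W) (downFrom N)

  -- Collisions are charged to the lower pair (w , k); the partner (w + d , k + h) may leave the grid.
  collisionsAt : ℕ → ℕ × ℕ → ℕ
  collisionsAt t (w , k) = sumOver (downFrom W) λ d → sumOver (downFrom (3 * suc d)) λ h →
    indicator (collides? t w k (suc d) h)

  collisions : ℕ → ℕ
  collisions t = sumOver grid (collisionsAt t)

  -- `k` moves innermost because the uniqueness of `k` holds for fixed w, d and h.
  collisions-reorder : ∀ t → collisions t ≡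
    sumOver (downFrom W) λ w → sumOver (downFrom W) λ d → sumOver (downFrom (3 * suc d)) λ h →
      sumOver (downFrom N) λ k → indicator (collides? t w k (suc d) h)
  collisions-reorder t = trans (sumOver-cartesianProduct (downFrom W) (downFrom N) (collisionsAt t))
    (sumOver-cong (downFrom W) λ w → trans (sumOver-swap (downFrom N) (downFrom W) _)
      (sumOver-cong (downFrom W) λ d → sumOver-swap (downFrom N) (downFrom (3 * suc d)) _))

  collisions-at-shift : ∀ w d h → d < W →
    suc d * sumOver slopes (λ t → sumOver (downFrom N) λ k → indicator (collides? t w k (suc d) h)) ≤ 3 * W
  collisions-at-shift w d h d<W = begin
    suc d * sumOver slopes (λ t → sumOver (downFrom N) λ k → indicator (collides? t w k (suc d) h))
      ≡⟨ cong (suc d *_) (sumOver-swap slopes (downFrom N) _) ⟩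
    suc d * sumOver (downFrom N) (λ k → sumOver slopes λ t → indicator (collides? t w k (suc d) h))
      ≤⟨ *-sumOver-single-≤ (suc d) (Unique.downFrom⁺ N) single few ⟩
    3 * W ∎
    where
    open ≤-Reasoning
    slopesAt : ℕ → ℕ
    slopesAt k = sumOver slopes λ t → indicator (collides? t w k (suc d) h)
    single : ∀ {k₁ k₂} → k₁ ∈ downFrom N → k₂ ∈ downFrom N → slopesAt k₁ ≢ 0 → slopesAt k₂ ≢ 0 → k₁ ≡ k₂
    single {k₁} {k₂} k₁∈ k₂∈ ne₁ ne₂ with sumOver≢0⇒∃ slopes ne₁ | sumOver≢0⇒∃ slopes ne₂
    ... | t₁ , t₁∈ , c₁ | t₂ , t₂∈ , c₂ = collides-k-unique {t₁} {t₂} {w} {k₁} {k₂} {suc d} {h}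
      (∈-downFrom⁻ t₁∈) (∈-downFrom⁻ t₂∈) (∈-downFrom⁻ k₁∈) (∈-downFrom⁻ k₂∈) z<s
      (indicator≢0⇒ (collides? t₁ w k₁ (suc d) h) c₁) (indicator≢0⇒ (collides? t₂ w k₂ (suc d) h) c₂)
    few : ∀ {k} → k ∈ downFrom N → suc d * slopesAt k ≤ 3 * W
    few {k} _ = begin
      suc d * slopesAt k ≤⟨ count-spread (λ t → collides? t w k (suc d) h) W (suc d)
                              (λ t s c₁ c₂ _ → collides-t-close {w} {k} {suc d} {h} t s c₁ c₂) ⟩
      -- The extra summand of `count-spread` is absorbed by the distance being at most W.
      2 * W + suc d      ≤⟨ +-monoʳ-≤ (2 * W) d<W ⟩
      2 * W + W          ≡⟨ +-comm (2 * W) W ⟩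
      3 * W              ∎

  -- At distance D = `suc d` there are 3D shifts h with at most 3W/D collisions each, so D cancels
  -- and the bound is the same for all distances.
  collisions-at-distance : ∀ w d → d < W →
    sumOver slopes (λ t → sumOver (downFrom (3 * suc d)) λ h → sumOver (downFrom N) λ k →
      indicator (collides? t w k (suc d) h)) ≤ 9 * W
  collisions-at-distance w d d<W = *-cancelˡ-≤ (suc d) (begin
    suc d * total
      ≤⟨ *-sumOver-swap-≤ (suc d) slopes (downFrom (3 * suc d)) (λ {h} _ → collisions-at-shift w d h d<W) ⟩
    length (downFrom (3 * suc d)) * (3 * W)  ≡⟨ cong (_* (3 * W)) (length-downFrom (3 * suc d)) ⟩
    3 * suc d * (3 * W)                      ≡⟨ eq (suc d) W ⟩
    suc d * (9 * W)                          ∎)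
    where
    open ≤-Reasoning
    total = sumOver slopes (λ t → sumOver (downFrom (3 * suc d)) λ h → sumOver (downFrom N) λ k →
      indicator (collides? t w k (suc d) h))
    eq : ∀ d W → 3 * d * (3 * W) ≡ d * (9 * W)
    eq = solve-∀

  total-collisions : sumOver slopes collisions ≤ length slopes * (9 * (W * W))
  total-collisions = begin
    sumOver slopes collisions ≡⟨ sumOver-cong slopes collisions-reorder ⟩
    -- The weight 1 brings the sum into the form of `*-sumOver-swap-≤`, applied to w and then to d.
    _ ≡⟨ *-identityˡ _ ⟨
    _ ≤⟨ *-sumOver-swap-≤ 1 slopes (downFrom W) (λ {w} _ → *-sumOver-swap-≤ 1 slopes (downFrom W)
           (λ {d} d∈ → ≤-trans (≤-reflexive (*-identityˡ _)) (collisions-at-distance w d (∈-downFrom⁻ d∈)))) ⟩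
    length (downFrom W) * (length (downFrom W) * (9 * W))
      ≡⟨ cong (λ l → length (downFrom W) * (l * (9 * W))) (length-downFrom W) ⟩
    length (downFrom W) * (W * (9 * W)) ≡⟨ cong (length (downFrom W) *_) (eq W) ⟩
    length (downFrom W) * (9 * (W * W)) ∎
    where
    open ≤-Reasoning
    eq : ∀ W → W * (9 * W) ≡ 9 * (W * W)
    eq = solve-∀

  few-collisions : ∃ λ t → t < W × collisions t ≤ 9 * (W * W)
  few-collisions = map₂ (map₁ ∈-downFrom⁻)
    (∃-≤-average slopes (subst (0 <_) (sym (length-downFrom W)) (>-nonZero⁻¹ W)) total-collisions)

  -- Distinct sums for a fixed slope

  module Slanted (t : ℕ) (t<W : t < W) where

    private
      -- Truncated subtraction keeps the walk at 0 up to `v₀`, which makes all signs before it -1.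
      lift : ℕ → ℕ
      lift j = level t (j ∸ v₀)

    lift-mono : ∀ i → lift i ≤ lift (suc i)
    lift-mono i = subst (λ x → lift i ≤ level t x) (m+[n∸m]≡n (∸-monoˡ-≤ v₀ (n≤1+n i))) (level-mono t (i ∸ v₀) _)

    lift-lipschitz : ∀ i → lift (suc i) ≤ suc (lift i)
    lift-lipschitz i = begin
      lift (suc i)
        ≤⟨ subst (λ x → level t (suc i ∸ v₀) ≤ level t x) (m+[n∸m]≡n bound) (level-mono t (suc i ∸ v₀) _) ⟩
      level t (i ∸ v₀ + 1)  ≤⟨ level-lipschitz (<⇒≤ t<W) (i ∸ v₀) 1 ⟩
      lift i + 1            ≡⟨ +-comm (lift i) 1 ⟩
      suc (lift i)          ∎
      where
      open ≤-Reasoning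
      bound : suc i ∸ v₀ ≤ i ∸ v₀ + 1
      bound = ≤-trans (m≤n+o⇒m∸n≤o (suc i) v₀ (≤-trans (s≤s (m≤n+m∸n i v₀)) (≤-reflexive (sym (+-suc v₀ _)))))
        (≤-reflexive (+-comm 1 (i ∸ v₀)))

    open Walk lift lift-mono lift-lipschitz public

    height-flat : ∀ {k} → k < N → height (N + k) ≡ pent (N + k)
    height-flat {k} k<N = trans (cong (λ x → pent (N + k) + 2 * level t x) (m≤n⇒m∸n≡0 (+-monoʳ-≤ N (<⇒≤ k<N))))
      (trans (cong (λ x → pent (N + k) + 2 * x) (0/n≡0 W)) (+-identityʳ _))

    height-steep : ∀ w → height (v₀ + w) ≡ pent (v₀ + w) + 2 * level t w
    height-steep w = cong (λ x → pent (v₀ + w) + 2 * level t x) (m+n∸m≡n v₀ w)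

    value : ℕ × ℕ → ℤ
    value (w , k) = (+ height (v₀ + w)) - (+ height (N + k))

    -- Of two grid pairs with equal sums and different w, the one with smaller w is charged and
    -- hence dropped here.
    good : List (ℕ × ℕ)
    good = filter (λ x → collisionsAt t x ≟ 0) grid

    value-equation : ∀ {w k w′ k′} → k < N → k′ < N → value (w , k) ≡ value (w′ , k′) →
      pent (v₀ + w) + 2 * level t w + pent (N + k′) ≡ pent (v₀ + w′) + 2 * level t w′ + pent (N + k)
    value-equation {w} {k} {w′} {k′} k<N k′<N eq = subst₂ _≡_
      (cong₂ _+_ (height-steep w) (height-flat k′<N)) (cong₂ _+_ (height-steep w′) (height-flat k<N))
      (≡-differences (height (v₀ + w)) (height (N + k)) (height (v₀ + w′)) (height (N + k′)) eq)

    -- `collisionsAt` counts positive distances only; equal w is settled here by strict growth of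
    -- `pent`.
    value-injectiveʳ : ∀ {w k k′} → k < N → k′ < N → value (w , k) ≡ value (w , k′) → k ≡ k′
    value-injectiveʳ {w} {k} {k′} k<N k′<N eq with <-cmp k k′
    ... | tri≈ _ k≡k′ _ = k≡k′
    ... | tri< lt _ _ = contradiction (sym (+-cancelˡ-≡ _ _ _ (value-equation {w} {k} {w} {k′} k<N k′<N eq)))
      (<⇒≢ (pent-mono-< (+-monoʳ-< N lt)))
    ... | tri> _ _ gt = contradiction (+-cancelˡ-≡ _ _ _ (value-equation {w} {k} {w} {k′} k<N k′<N eq))
      (<⇒≢ (pent-mono-< (+-monoʳ-< N gt)))

    -- Heights increase, so a higher end point needs a higher starting point for the same sum. This
    -- makes `k′ ∸ k` a genuine difference in `good-≢-below`.
    value-≡⇒k≤ : ∀ {w k w′ k′} → k < N → k′ < N → w ≤ w′ → value (w , k) ≡ value (w′ , k′) → k ≤ k′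
    value-≡⇒k≤ {w} {k} {w′} {k′} k<N k′<N w≤w′ eq with k ≤? k′
    ... | yes k≤k′ = k≤k′
    ... | no k≰k′ = contradiction (value-equation {w} {k} {w′} {k′} k<N k′<N eq) (<⇒≢ (+-mono-≤-<
      (+-mono-≤ (pent-mono-≤ (+-monoʳ-≤ v₀ w≤w′))
        (*-monoʳ-≤ 2 (subst (λ x → level t w ≤ level t x) (m+[n∸m]≡n w≤w′) (level-mono t w _))))
      (pent-mono-< (+-monoʳ-< N (≰⇒> k≰k′)))))

    value-≡⇒collision : ∀ {w k d h} → k < N → k + h < N → value (w , k) ≡ value (w + d , k + h) → Collides t w k d h
    value-≡⇒collision {w} {k} {d} {h} k<N k+h<N eq = collision (sym (+-cancelˡ-≡ (pent (v₀ + w) + pent (N + k)) _ _ (begin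
      pent (v₀ + w) + pent (N + k) + (pent h + 3 * (N + k) * h + 2 * level t w)
        ≡⟨ shuffle (pent (v₀ + w)) (pent (N + k)) (pent h + 3 * (N + k) * h) (level t w) ⟩
      pent (v₀ + w) + 2 * level t w + (pent (N + k) + (pent h + 3 * (N + k) * h))
        ≡⟨ cong (λ x → pent (v₀ + w) + 2 * level t w + x) (trans (cong pent (sym (+-assoc N k h))) (pent-+ (N + k) h)) ⟨
      pent (v₀ + w) + 2 * level t w + pent (N + (k + h))
        ≡⟨ value-equation {w} {k} {w + d} {k + h} k<N k+h<N eq ⟩
      pent (v₀ + (w + d)) + 2 * level t (w + d) + pent (N + k)
        ≡⟨ cong (λ x → x + 2 * level t (w + d) + pent (N + k)) (trans (cong pent (sym (+-assoc v₀ w d))) (pent-+ (v₀ + w) d)) ⟩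
      pent (v₀ + w) + (pent d + 3 * (v₀ + w) * d) + 2 * level t (w + d) + pent (N + k)
        ≡⟨ shuffle′ (pent (v₀ + w)) (pent (N + k)) (pent d + 3 * (v₀ + w) * d) (level t (w + d)) ⟩
      pent (v₀ + w) + pent (N + k) + (pent d + 3 * (v₀ + w) * d + 2 * level t (w + d)) ∎)))
      where
      open ≡-Reasoning
      shuffle : ∀ p q x a → p + q + (x + 2 * a) ≡ p + 2 * a + (q + x)
      shuffle = solve-∀
      shuffle′ : ∀ p q x a → p + x + 2 * a + q ≡ p + q + (x + 2 * a)
      shuffle′ = solve-∀

    good-≢-below : ∀ {w k w′ k′} → w′ < W → k < N → k′ < N → w < w′ →
      collisionsAt t (w , k) ≡ 0 → value (w , k) ≢ value (w′ , k′)
    good-≢-below {w} {k} {w′} {k′} w′<W k<N k′<N w<w′ none eq =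
      indicator≡0⇒¬ (collides? t w k (suc d) h)
        (sumOver≡0⇒≡0 (downFrom (3 * suc d)) (sumOver≡0⇒≡0 (downFrom W) none (∈-downFrom⁺ d<W)) (∈-downFrom⁺ h<3d)) coll
      where
      -- One less than the distance w′ - w, since `collisionsAt` sums over `suc d`.
      d = w′ ∸ suc w
      h = k′ ∸ k
      w+d≡w′ : w + suc d ≡ w′
      w+d≡w′ = trans (+-suc w d) (m+[n∸m]≡n w<w′)
      k+h≡k′ : k + h ≡ k′
      k+h≡k′ = m+[n∸m]≡n (value-≡⇒k≤ {w} {k} {w′} {k′} k<N k′<N (<⇒≤ w<w′) eq)
      coll : Collides t w k (suc d) h
      coll = value-≡⇒collision k<N (subst (_< N) (sym k+h≡k′) k′<N)
        (subst₂ (λ x y → value (w , k) ≡ value (x , y)) (sym w+d≡w′) (sym k+h≡k′) eq)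
      d<W : d < W
      d<W = ≤-<-trans (m∸n≤m w′ (suc w)) w′<W
      h<3d : h < 3 * suc d
      h<3d = collision⇒h<3d z<s (≤-<-trans (+-monoˡ-≤ 2 (*-monoʳ-≤ 3 (+-monoʳ-≤ v₀ (<⇒≤ (<-trans w<w′ w′<W)))))
        (<-≤-trans v<3u (*-monoʳ-≤ 9 (m≤m+n N k)))) (level-lipschitz (<⇒≤ t<W) w (suc d)) coll

    good⁻ : ∀ {w k} → (w , k) ∈ good → w < W × k < N × collisionsAt t (w , k) ≡ 0
    good⁻ x∈ with ∈-filter⁻ (λ x → collisionsAt t x ≟ 0) {xs = grid} x∈
    ... | x∈grid , none with ∈-cartesianProduct⁻ (downFrom W) (downFrom N) x∈grid
    ...   | w∈ , k∈ = ∈-downFrom⁻ w∈ , ∈-downFrom⁻ k∈ , none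

    value-injective : ∀ {x y} → x ∈ good → y ∈ good → value x ≡ value y → x ≡ y
    value-injective {w , k} {w′ , k′} x∈ y∈ eq with good⁻ x∈ | good⁻ y∈
    ... | w<W , k<N , none | w′<W , k′<N , none′ with <-cmp w w′
    ...   | tri< lt _ _ = contradiction eq (good-≢-below w′<W k<N k′<N lt none)
    ...   | tri> _ _ gt = contradiction (sym eq) (good-≢-below w<W k′<N k<N gt none′)
    ...   | tri≈ _ refl _ = cong (w ,_) (value-injectiveʳ {w} k<N k′<N eq)

    values-unique : Unique (map value good)
    values-unique = map-unique value value-injective
      (Unique.filter⁺ _ (Unique.cartesianProduct⁺ (Unique.downFrom⁺ W) (Unique.downFrom⁺ N)))

    values⊆consecSums : ∀ {n z} → v₀ + W ≤ n → z ∈ map value good → z ∈ consecSums (seqA (signs n))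
    values⊆consecSums {n} n≥ z∈ with ∈-map⁻ value z∈
    ... | (w , k) , x∈ , refl with good⁻ x∈
    ...   | w<W , k<N , _ = height-difference∈ n
      (<-≤-trans (+-monoʳ-< N k<N) (m≤m+n v₀ w)) (≤-trans (+-monoʳ-≤ v₀ (<⇒≤ w<W)) n≥)

    grid≤cardS+collisions : ∀ {n} → v₀ + W ≤ n → W * N ≤ cardS (seqA (signs n)) + collisions t
    grid≤cardS+collisions {n} n≥ = begin
      W * N                                             ≡⟨ cong₂ _*_ (length-downFrom W) (length-downFrom N) ⟨
      length (downFrom W) * length (downFrom N)         ≡⟨ length-cartesianProduct (downFrom W) (downFrom N) ⟨
      length grid                                       ≤⟨ length≤filter+sumOver (collisionsAt t) grid ⟩
      length good + collisions t                        ≡⟨ cong (_+ collisions t) (length-map value good) ⟨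
      length (map value good) + collisions t            ≤⟨ +-monoˡ-≤ (collisions t)
                                                             (length≤cardS (seqA (signs n)) values-unique (values⊆consecSums n≥)) ⟩
      cardS (seqA (signs n)) + collisions t             ∎
      where open ≤-Reasoning

  ∃-large-cardS : ∀ {n} → v₀ + W ≤ n → ∃ λ (ε : Vec Bool n) → W * N ≤ cardS (seqA ε) + 9 * (W * W)
  ∃-large-cardS {n} n≥ =
    let t , t<W , c≤ = few-collisions in
    Slanted.signs t t<W n , ≤-trans (Slanted.grid≤cardS+collisions t t<W n≥) (+-monoʳ-≤ _ c≤)

-- Choice of parameters and the constant

cardS-positive : ∀ {n} (ε : Vec Bool (suc n)) → 0 < cardS (seqA ε)
cardS-positive ε = ∈-length (∈-deduplicate⁺ ℤ._≟_ {consecSums (seqA ε)} (here refl))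

square-≤ : ∀ a b c {n w x} → n ≤ a * w → b * (w * w) ≤ x → a * a ≤ c * b → n * n ≤ c * x
square-≤ a b c {n} {w} {x} n≤aw bw²≤x a²≤cb = begin
  n * n             ≤⟨ *-mono-≤ n≤aw n≤aw ⟩
  a * w * (a * w)   ≡⟨ eq a w ⟩
  a * a * (w * w)   ≤⟨ *-monoˡ-≤ (w * w) a²≤cb ⟩
  c * b * (w * w)   ≡⟨ *-assoc c b (w * w) ⟩
  c * (b * (w * w)) ≤⟨ *-monoʳ-≤ c bw²≤x ⟩
  c * x             ∎
  where
  open ≤-Reasoning
  eq : ∀ a w → a * w * (a * w) ≡ a * a * (w * w)
  eq = solve-∀

-- The remainder is below d, hence at most d times the positive quotient: rounding down costs at
-- most a factor 2.
n≤2d[n/d] : ∀ n d {{_ : NonZero d}} → 0 < n / d → n ≤ (d + d) * (n / d)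
n≤2d[n/d] n d 0<q = begin
  n                            ≡⟨ m≡m%n+[m/n]*n n d ⟩
  n % d + n / d * d            ≤⟨ +-mono-≤ (<⇒≤ (m%n<n n d)) (≤-reflexive (*-comm (n / d) d)) ⟩
  d + d * (n / d)              ≤⟨ +-monoˡ-≤ (d * (n / d)) (m≤m*n d (n / d) {{>-nonZero 0<q}}) ⟩
  d * (n / d) + d * (n / d)    ≡⟨ *-distribʳ-+ (n / d) d d ⟨
  (d + d) * (n / d)            ∎
  where open ≤-Reasoning

∃-9W²≤cardS : ∀ W n → 0 < W → W * 37 ≤ n → ∃ λ (ε : Vec Bool n) → 9 * (W * W) ≤ cardS (seqA ε)
∃-9W²≤cardS W n 0<W 37W≤n = map₂ (λ {ε} → bound ε)
  -- With N = 18W the grid has 18W² pairs, twice the collision bound 9W². The length needed is 2N +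
  -- W = 37W.
  (Grid.∃-large-cardS W (W * 18) (m<m*n W 18 (s≤s (s≤s z≤n))) (≤-trans (≤-reflexive (eq₁ W)) 37W≤n))
  where
  open ≤-Reasoning
  instance
    W≢0 : NonZero W
    W≢0 = >-nonZero 0<W
  eq₁ : ∀ W → W * 18 + W * 18 + W ≡ W * 37
  eq₁ = solve-∀
  eq₂ : ∀ W → 9 * (W * W) + 9 * (W * W) ≡ W * (W * 18)
  eq₂ = solve-∀
  bound : ∀ ε → W * (W * 18) ≤ cardS (seqA ε) + 9 * (W * W) → 9 * (W * W) ≤ cardS (seqA ε)
  bound ε h = +-cancelʳ-≤ (9 * (W * W)) _ _ (≤-trans (≤-reflexive (eq₂ W)) h)

∃-quadratic-cardS : ∀ c → 74 * 74 ≤ c * 9 → 36 * 36 ≤ c * 1 →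
  ∀ n → ∃ λ (ε : Vec Bool (suc n)) → suc n * suc n ≤ c * cardS (seqA ε)
∃-quadratic-cardS c 74²≤9c 36²≤c n = case (37 ≤? suc n)
  where
  large : ∀ W → 0 < W → W * 37 ≤ suc n → suc n ≤ 74 * W →
    ∃ λ (ε : Vec Bool (suc n)) → suc n * suc n ≤ c * cardS (seqA ε)
  large W 0<W 37W≤n n≤74W = map₂
    (λ {ε} 9W²≤ → square-≤ 74 9 c {suc n} {W} {cardS (seqA ε)} n≤74W 9W²≤ 74²≤9c)
    (∃-9W²≤cardS W (suc n) 0<W 37W≤n)
  case : Dec (37 ≤ suc n) → ∃ λ (ε : Vec Bool (suc n)) → suc n * suc n ≤ c * cardS (seqA ε)
  -- W is the integer part of n/37, so n ≤ 74W by the factor 2 lost in rounding.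
  case (yes 37≤n) = large (suc n / 37) (m≥n⇒m/n>0 37≤n) (m/n*n≤m (suc n) 37)
    (n≤2d[n/d] (suc n) 37 (m≥n⇒m/n>0 37≤n))
  -- Here n ≤ 36 and one element of S(a) suffices, so any sign pattern works.
  case (no 37≰n) = ε , square-≤ 36 1 c {suc n} {1} {cardS (seqA ε)} (s≤s⁻¹ (≰⇒> 37≰n)) (cardS-positive ε) 36²≤c
    where
    ε = Vec.replicate (suc n) true

theorem1p2 : Σ ℚ (λ c₂ → (0ℚ ℚ.< c₂) × ((n : ℕ) → 0ℚ ℚ.< probBig c₂ (suc n)))
theorem1p2 = c₂ , ℚ.positive⁻¹ c₂ , λ n →
    let ε , n²≤ = ∃-quadratic-cardS (suc 1999) 74²≤ 36²≤ n in
    probBig-positive c₂ (suc n) ε (1/[1+k]*m≤n 1999 (suc n * suc n) (cardS (seqA ε)) n²≤)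
  where
  c₂ : ℚ
  -- The two ranges of n require 1/c₂ to be at least 74²/9 (below 609) and 36² = 1296; 2000 is a
  -- round number above both.
  c₂ = (+ 1) ℚ./ 2000
  74²≤ : 74 * 74 ≤ suc 1999 * 9
  74²≤ = ≤ᵇ⇒≤ (74 * 74) (suc 1999 * 9) _
  36²≤ : 36 * 36 ≤ suc 1999 * 1
  36²≤ = ≤ᵇ⇒≤ (36 * 36) (suc 1999 * 1) _
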